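{- Let $p$ be a prime, $q=p^\lambda$ with $\lambda\ge1$, and let $F$ be a field with $\mathbb F_q\subseteq F$. Let $E=\{e_j(x)\}_{j=0}^\infty$ be a sequence of $\mathbb F_q$-linear polynomials in $F[x]$. For each integer $i\ge0$ with $q$-adic expansion $i=\sum_{t} i_tq^t$ ($0\le i_t<q$), put $$p_{E,i}(x):=\prod_t e_t(x)^{i_t}.$$ Then the sequence $P_E:=\{p_{E,i}(x)\}_{i=0}^\infty$ is a nontrivial sequence satisfying the Binomial Theorem (equivalently, its generating function lies in $\mathfrak{BD}^\ast$).
   Context: A polynomial in $F[x]$ is $\mathbb F_q$-linear if it is a finite $F$-linear combination of monomials $x^{q^n}$, $n\ge0$ (the zero polynomial is allowed). The convention $e^0=1$ is used, also for $e=0$. A sequence $P=\{p_i(x)\}_{i=0}^\infty$ of polynomials in $F[x]$ satisfies the Binomial Theorem if $p_n(x+y)=\sum_{i=0}^n \binom{n}{i}p_i(x)p_{n-i}(y)$ in $F[x,y]$ for all $n\ge 0$; it is nontrivial if not all $p_i(x)$ are zero. $F[x]\{\{\mathfrak D\}\}$ is the commutative ring of formal series $\sum_{i\ge0}a_i\mathfrak D_i$ ($a_i\in F[x]$) with $\mathfrak D_i\mathfrak D_j=\binom{i+j}{i}\mathfrak D_{i+j}$. The generating function of a sequence $P$ is $\sum_{i\ge0}p_i(x)\mathfrak D_i$, and $\mathfrak{BD}^\ast$ is the set of generating functions of all nontrivial sequences satisfying the Binomial Theorem. -}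

module Defs where

open import Algebra.Bundles using (CommutativeRing)
open import Algebra.Bundles.Raw using (RawRing)
import Algebra.Definitions
import Algebra.Definitions.RawSemiring
open import Data.Digit using (Expansion; toDigits)
open import Data.Fin.Base using (Fin; toℕ)
open import Data.List.Base using (List; []; _∷_; map)
open import Data.Nat.Base as ℕ using (ℕ; zero; suc; _∸_; _≤_; _≥_)
open import Data.Nat.Combinatorics using (_C_)
import Data.Nat.Properties as ℕ
open import Data.Nat.Primality using (Prime; prime⇒nonTrivial)
open import Data.Product.Base using (_×_; Σ-syntax; ∃-syntax; proj₁)
open import Data.Vec.Functional using (Vector)
open import Function.Base using (_∘_)
open import Function.Bundles using (Inverse)
open import Level using (Level; _⊔_) renaming (suc to lsuc)
import Relation.Binary.PropositionalEquality.Core as ≡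
open import Relation.Binary.PropositionalEquality.Properties using (setoid)
open import Relation.Nullary.Decidable using (fromWitness)
open import Relation.Nullary.Negation using (¬_)
open import Relation.Unary using (Pred)

private
  variable
    a b c ℓ ℓ′ : Level

-- `HeytingField` from the standard library does not require 1# and 0# to be
-- distinct, so it also admits the zero ring.

record Field c ℓ : Set (lsuc (c ⊔ ℓ)) where
  field
    commutativeRing : CommutativeRing c ℓ

  open CommutativeRing commutativeRing public
  open Algebra.Definitions _≈_ using (Invertible)

  field
    1≉0          : ¬ (1# ≈ 0#)
    ≉0⇒invertible : ∀ {x} → ¬ (x ≈ 0#) → Invertible 1# _*_ x

HasOrder : Field c ℓ → ℕ → Set (c ⊔ ℓ)
HasOrder K n = Inverse (Field.setoid K) (setoid (Fin n))

-- A polynomial is the list of its coefficients, constant term first.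
-- Trailing zeros are allowed; equality compares coefficients.

module Polynomial (R : RawRing c ℓ) where
  open RawRing R

  Poly : Set c
  Poly = List Carrier

  coeff : Poly → ℕ → Carrier
  coeff []      _       = 0#
  coeff (a ∷ f) zero    = a
  coeff (a ∷ f) (suc n) = coeff f n

  infixl 6 _+ₚ_
  _+ₚ_ : Poly → Poly → Poly
  []      +ₚ g       = g
  (a ∷ f) +ₚ []      = a ∷ f
  (a ∷ f) +ₚ (b ∷ g) = a + b ∷ f +ₚ g

  infixl 7 _*ₚ_
  _*ₚ_ : Poly → Poly → Poly
  []      *ₚ g = []
  (a ∷ f) *ₚ g = map (a *_) g +ₚ (0# ∷ f *ₚ g)

  const : Carrier → Poly
  const a = a ∷ []

  X : Poly
  X = 0# ∷ 1# ∷ []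

  polynomialRing : RawRing c ℓ
  polynomialRing = record
    { Carrier = Poly
    ; _≈_     = λ f g → ∀ n → coeff f n ≈ coeff g n
    ; _+_     = _+ₚ_
    ; _*_     = _*ₚ_
    ; -_      = map -_
    ; 0#      = []
    ; 1#      = const 1#
    }

  -- The value f(s) in S, with coefficients mapped into S along φ.

  eval : (S : RawRing a b) → (Carrier → RawRing.Carrier S) →
         Poly → RawRing.Carrier S → RawRing.Carrier S
  eval S φ []      s = RawRing.0# S
  eval S φ (a ∷ f) s = φ a S.+ s S.* eval S φ f s
    where module S = RawRing S

-- Formal series Σ aᵢ 𝔇ᵢ over R, given by i ↦ aᵢ; the product is the one
-- determined by 𝔇ᵢ 𝔇ⱼ = (i + j choose i) 𝔇ᵢ₊ⱼ.

dividedPowerSeries : RawRing c ℓ → RawRing c ℓ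
dividedPowerSeries R = record
  { Carrier = ℕ → Carrier
  ; _≈_     = λ u v → ∀ n → u n ≈ v n
  ; _+_     = λ u v n → u n + v n
  ; _*_     = λ u v n →
      sum {suc n} λ i → (n C toℕ i) · (u (toℕ i) * v (n ∸ toℕ i))
  ; -_      = λ u n → - u n
  ; 0#      = λ _ → 0#
  ; 1#      = λ { zero → 1# ; (suc _) → 0# }
  }
  where
  open RawRing R
  open Algebra.Definitions.RawSemiring rawSemiring using (sum)
    renaming (_×_ to _·_)

2≤p^l : ∀ {p l} → Prime p → l ≥ 1 → 2 ≤ p ℕ.^ l
2≤p^l {p} {l} pr l≥1 = ℕ.≤-trans 2≤p p≤p^l
  where
  instance
    _ = prime⇒nonTrivial pr
    _ = ℕ.nonTrivial⇒nonZero p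
  2≤p : 2 ≤ p
  2≤p = ℕ.nonTrivial⇒n>1 p
  p≤p^l : p ≤ p ℕ.^ l
  p≤p^l = ℕ.≤-trans (ℕ.≤-reflexive (≡.sym (ℕ.^-identityʳ p))) (ℕ.^-monoʳ-≤ p l≥1)

module BinomialSequences (F : Field c ℓ) where

  private module F = Field F

  F[x] : RawRing c ℓ
  F[x] = Polynomial.polynomialRing F.rawRing

  F[x,y] : RawRing c ℓ
  F[x,y] = Polynomial.polynomialRing F[x]

  F[x]⟪𝔇⟫ : RawRing c ℓ
  F[x]⟪𝔇⟫ = dividedPowerSeries F[x]

  private
    module F[x]    = RawRing F[x]
    module F[x,y]  = RawRing F[x,y]
    module F[x]⟪𝔇⟫ = RawRing F[x]⟪𝔇⟫
    module Px  = Polynomial F.rawRing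
    module Pxy = Polynomial F[x]

  Sequence : Set c
  Sequence = ℕ → F[x].Carrier

  x y : F[x,y].Carrier
  x = Pxy.const Px.X
  y = Pxy.X

  infix 9 _⟨_⟩
  _⟨_⟩ : F[x].Carrier → F[x,y].Carrier → F[x,y].Carrier
  f ⟨ s ⟩ = Px.eval F[x,y] (Pxy.const ∘ Px.const) f s

  IsLinear : ℕ → Pred F[x].Carrier (c ⊔ ℓ)
  IsLinear q f = ∃[ m ] Σ[ as ∈ Vector F.Carrier m ]
    f F[x].≈ sum {m} (λ n → Px.const (as n) F[x].* Px.X ^ (q ℕ.^ toℕ n))
    where open Algebra.Definitions.RawSemiring F[x].rawSemiring using (sum; _^_)

  SatisfiesBinomialTheorem : Pred Sequence ℓ
  SatisfiesBinomialTheorem P = ∀ n →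
    P n ⟨ x F[x,y].+ y ⟩ F[x,y].≈
      sum {suc n} λ i → (n C toℕ i) · (P (toℕ i) ⟨ x ⟩ F[x,y].* P (n ∸ toℕ i) ⟨ y ⟩)
    where
    open Algebra.Definitions.RawSemiring F[x,y].rawSemiring using (sum)
      renaming (_×_ to _·_)

  Nontrivial : Pred Sequence ℓ
  Nontrivial P = ¬ (∀ i → P i F[x].≈ F[x].0#)

  generatingFunction : Sequence → F[x]⟪𝔇⟫.Carrier
  generatingFunction P i = P i

  𝔅𝔇* : Pred F[x]⟪𝔇⟫.Carrier (c ⊔ ℓ)
  𝔅𝔇* u = ∃[ P ] Nontrivial P × SatisfiesBinomialTheorem P ×
                 u F[x]⟪𝔇⟫.≈ generatingFunction P

  -- ∏ₜ eₜ^(iₜ) for a digit expansion i₀ ∷ i₁ ∷ …, least significant first.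

  digitProduct : ∀ {q} → Sequence → Expansion q → F[x].Carrier
  digitProduct E []       = F[x].1#
  digitProduct E (d ∷ ds) = E 0 ^ toℕ d F[x].* digitProduct (E ∘ suc) ds
    where open Algebra.Definitions.RawSemiring F[x].rawSemiring using (_^_)

  digitSequence : ∀ q → 2 ≤ q → Sequence → Sequence
  digitSequence q 2≤q E i =
    digitProduct E (proj₁ (toDigits q {fromWitness 2≤q} i))

{-# OPTIONS --safe #-}

-- Put B n T = Σᵢ (n choose i) T i (n ∸ i), so that Pascal's rule reads
-- B (n + 1) T = B n (D₁ T) + B n (D₂ T) with D₁, D₂ the shifts of the two
-- arguments of T. Since D₁ and D₂ commute, in characteristic p also
-- B (q + n) T = B n (D₁^q T) + B n (D₂^q T) for q a power of p: a q-fold step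
-- obeys the same rule as a single one, which replaces Lucas' theorem. If
-- T i j = Uᵢ Vⱼ for the digit products U, V of sequences u, v in a ring, then
-- splitting off the lowest digit of n = r + m q shows that B n T is
-- (u₀ + v₀)^r times the same expression for m and the sequences u, v shifted
-- by one, hence by induction the n-th digit product of u + v. Linear
-- polynomials are additive in characteristic p, so this applies to the values
-- of the eₜ at x and at y.

module Submission where

open import Defs
open import Algebra.Bundles
  using (AbelianGroup; CommutativeRing; CommutativeSemiring; Semiring)
open import Algebra.Bundles.Raw using (RawRing)
import Algebra.Construct.Pointwise as Pointwise
import Algebra.Definitions.RawSemiring
import Algebra.Morphism.Construct.Composition as Composition
import Algebra.Morphism.Construct.Identity as Identity
import Algebra.Morphism.GroupMonomorphism as GroupMonomorphism
import Algebra.Morphism.RingMonomorphism as RingMonomorphism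
open import Algebra.Morphism.Structures using (module GroupMorphisms; module RingMorphisms)
import Algebra.Properties.CommutativeMonoid.Sum
import Algebra.Properties.CommutativeSemigroup
import Algebra.Properties.Group
import Algebra.Properties.Ring
import Algebra.Properties.Semiring.Exp
import Algebra.Properties.Semiring.Mult
open import Algebra.Structures using (IsAbelianGroup)
open import Data.Digit using (Expansion; fromDigits; toDigits)
open import Data.Fin.Base as Fin using (Fin; fromℕ; fromℕ<; inject₁; toℕ)
import Data.Fin.Properties as Fin
open import Data.Fin.Permutation using (Permutation; permutation)
open import Data.Fin.Properties
  using (toℕ<n; toℕ-fromℕ; toℕ-fromℕ<; toℕ-inject₁; toℕ-injective)
open import Data.List.Base using ([]; _∷_; map)
open import Data.Nat.Base as ℕ
  using (ℕ; zero; suc; z≤n; s≤s; _∸_; _!; _≤_; _<_; _≥_)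
open import Data.Nat.Combinatorics
  using (_C_; k![n∸k]!∣n!; k>n⇒nCk≡0; nCk+nC[k+1]≡[n+1]C[k+1]; nCk≡n!/k![n-k]!; nCn≡1)
open import Data.Nat.Divisibility using (_∣_; divides; ∣⇒≤; m∣m*n)
open import Data.Nat.DivMod using (_%_; [m+kn]%n≡m%n; m/n*n≡m; m<n⇒m%n≡m)
open import Data.Nat.Primality using (Prime; euclidsLemma; prime⇒nonTrivial)
import Data.Nat.Properties as ℕ
open import Data.Product.Base using (_×_; _,_; proj₁; proj₂)
open import Data.Sum.Base using (inj₁; inj₂)
open import Data.Vec.Functional using (Vector)
open import Function.Base using (id; _∘_)
open import Function.Bundles using (Inverse)
open import Function.Properties.Inverse using (Inverse⇒Injection)
open import Level using (Level; _⊔_)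
open import Relation.Binary.PropositionalEquality as ≡ using (_≡_)
import Relation.Binary.Reasoning.Setoid as SetoidReasoning
open import Relation.Nullary.Decidable using (Dec; yes; no; fromWitness; via-injection)
open import Relation.Nullary.Negation using (¬_; contradiction)
open import Relation.Unary using (_∈_)

private
  variable
    c ℓ c′ ℓ′ : Level

-- The commutative ring of polynomials

module PolynomialRing (R : CommutativeRing c ℓ) where
  open CommutativeRing R hiding (_-_)
  open Polynomial rawRing

  -- A record, so that the two polynomials can be inferred from a proof.
  infix 4 _≋_
  record _≋_ (f g : Poly) : Set ℓ where
    constructor coefficientwise
    field coefficients : ∀ n → coeff f n ≈ coeff g n

  open _≋_

  private
    scale : Carrier → Poly → Poly
    scale a = map (a *_)

  coeff-+ : ∀ f g n → coeff (f +ₚ g) n ≈ coeff f n + coeff g n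
  coeff-+ []      g       n       = sym (+-identityˡ _)
  coeff-+ (a ∷ f) []      n       = sym (+-identityʳ _)
  coeff-+ (a ∷ f) (b ∷ g) zero    = refl
  coeff-+ (a ∷ f) (b ∷ g) (suc n) = coeff-+ f g n

  coeff-neg : ∀ f n → coeff (map -_ f) n ≈ - coeff f n
  coeff-neg []      n       = sym -0#≈0#
    where open Algebra.Properties.Ring ring using (-0#≈0#)
  coeff-neg (a ∷ f) zero    = refl
  coeff-neg (a ∷ f) (suc n) = coeff-neg f n

  coeff-scale : ∀ a f n → coeff (map (a *_) f) n ≈ a * coeff f n
  coeff-scale a []      n       = sym (zeroʳ a)
  coeff-scale a (b ∷ f) zero    = refl
  coeff-scale a (b ∷ f) (suc n) = coeff-scale a f n

  -- `_≋_` is equality after `coeff`, so the group laws are pulled back from the pointwise group of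
  -- functions on `ℕ`, without case analysis on lists of unequal length.
  +ₚ-isAbelianGroup : IsAbelianGroup _≋_ _+ₚ_ [] (map -_)
  +ₚ-isAbelianGroup =
    GroupMonomorphism.isAbelianGroup coeff-isGroupMonomorphism
      (Pointwise.isAbelianGroup ℕ +-isAbelianGroup)
    where
    coeff-isGroupMonomorphism : GroupMorphisms.IsGroupMonomorphism
      (record { _≈_ = _≋_ ; _∙_ = _+ₚ_ ; ε = [] ; _⁻¹ = map -_ })
      (AbelianGroup.rawGroup (Pointwise.abelianGroup ℕ +-abelianGroup)) coeff
    coeff-isGroupMonomorphism = record
      { isGroupHomomorphism = record
        { isMonoidHomomorphism = record
          { isMagmaHomomorphism = record
            { isRelHomomorphism = record { cong = coefficients }
            ; homo = coeff-+
            }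
          ; ε-homo = λ _ → refl
          }
        ; ⁻¹-homo = coeff-neg
        }
      ; injective = coefficientwise
      }

  private
    +ₚ-abelianGroup : AbelianGroup c ℓ
    +ₚ-abelianGroup = record { isAbelianGroup = +ₚ-isAbelianGroup }

    module P = AbelianGroup +ₚ-abelianGroup

  open Algebra.Properties.CommutativeSemigroup P.commutativeSemigroup
    using (interchange; x∙yz≈y∙xz)
  open SetoidReasoning P.setoid

  ∷-cong : ∀ {a b f g} → a ≈ b → f ≋ g → a ∷ f ≋ b ∷ g
  ∷-cong a≈b f≋g = coefficientwise λ
    { zero → a≈b ; (suc n) → coefficients f≋g n }

  0∷[]≋[] : 0# ∷ [] ≋ []
  0∷[]≋[] = coefficientwise λ { zero → refl ; (suc n) → refl }

  0∷-distrib-+ : ∀ f g → 0# ∷ (f +ₚ g) ≋ (0# ∷ f) +ₚ (0# ∷ g)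
  0∷-distrib-+ f g = ∷-cong (sym (+-identityˡ 0#)) P.refl

  scale-cong : ∀ a {f g} → f ≋ g → scale a f ≋ scale a g
  scale-cong a {f} {g} f≋g = coefficientwise λ n →
    trans (coeff-scale a f n)
      (trans (*-congˡ (coefficients f≋g n)) (sym (coeff-scale a g n)))

  scale-distribˡ-+ : ∀ a f g → scale a (f +ₚ g) ≋ scale a f +ₚ scale a g
  scale-distribˡ-+ a []      g       = P.refl
  scale-distribˡ-+ a (b ∷ f) []      = P.refl
  scale-distribˡ-+ a (b ∷ f) (d ∷ g) =
    ∷-cong (distribˡ a b d) (scale-distribˡ-+ a f g)

  scale-distribʳ-+ : ∀ a b f → scale (a + b) f ≋ scale a f +ₚ scale b f
  scale-distribʳ-+ a b []      = P.refl
  scale-distribʳ-+ a b (d ∷ f) = ∷-cong (distribʳ d a b) (scale-distribʳ-+ a b f)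

  scale-scale : ∀ a b f → scale (a * b) f ≋ scale a (scale b f)
  scale-scale a b []      = P.refl
  scale-scale a b (d ∷ f) = ∷-cong (*-assoc a b d) (scale-scale a b f)

  scale-identity : ∀ f → scale 1# f ≋ f
  scale-identity []      = P.refl
  scale-identity (a ∷ f) = ∷-cong (*-identityˡ a) (scale-identity f)

  scale-zero : ∀ f → scale 0# f ≋ []
  scale-zero []      = P.refl
  scale-zero (a ∷ f) = P.trans (∷-cong (zeroˡ a) (scale-zero f)) 0∷[]≋[]

  *ₚ-distribʳ-+ₚ : ∀ h f g → (f +ₚ g) *ₚ h ≋ f *ₚ h +ₚ g *ₚ h
  *ₚ-distribʳ-+ₚ h []      g       = P.refl
  *ₚ-distribʳ-+ₚ h (a ∷ f) []      = P.sym (P.identityʳ _)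
  *ₚ-distribʳ-+ₚ h (a ∷ f) (b ∷ g) = begin
    scale (a + b) h +ₚ (0# ∷ (f +ₚ g) *ₚ h)
      ≈⟨ P.∙-cong (scale-distribʳ-+ a b h)
           (P.trans (∷-cong refl (*ₚ-distribʳ-+ₚ h f g))
             (0∷-distrib-+ (f *ₚ h) (g *ₚ h))) ⟩
    (scale a h +ₚ scale b h) +ₚ ((0# ∷ f *ₚ h) +ₚ (0# ∷ g *ₚ h))
      ≈⟨ interchange (scale a h) (scale b h) (0# ∷ f *ₚ h) (0# ∷ g *ₚ h) ⟩
    (a ∷ f) *ₚ h +ₚ (b ∷ g) *ₚ h ∎

  *ₚ-distribˡ-+ₚ : ∀ f g h → f *ₚ (g +ₚ h) ≋ f *ₚ g +ₚ f *ₚ h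
  *ₚ-distribˡ-+ₚ []      g h = P.refl
  *ₚ-distribˡ-+ₚ (a ∷ f) g h = begin
    scale a (g +ₚ h) +ₚ (0# ∷ f *ₚ (g +ₚ h))
      ≈⟨ P.∙-cong (scale-distribˡ-+ a g h)
           (P.trans (∷-cong refl (*ₚ-distribˡ-+ₚ f g h))
             (0∷-distrib-+ (f *ₚ g) (f *ₚ h))) ⟩
    (scale a g +ₚ scale a h) +ₚ ((0# ∷ f *ₚ g) +ₚ (0# ∷ f *ₚ h))
      ≈⟨ interchange (scale a g) (scale a h) (0# ∷ f *ₚ g) (0# ∷ f *ₚ h) ⟩
    (a ∷ f) *ₚ g +ₚ (a ∷ f) *ₚ h ∎

  *ₚ-zeroʳ : ∀ f → f *ₚ [] ≋ []
  *ₚ-zeroʳ []      = P.refl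
  *ₚ-zeroʳ (a ∷ f) = P.trans (∷-cong refl (*ₚ-zeroʳ f)) 0∷[]≋[]

  -- The mirror image of the defining clause of `_*ₚ_`, from which commutativity follows by
  -- induction. Commutativity of `R` enters in the heads.
  *ₚ-∷ʳ : ∀ f b g → f *ₚ (b ∷ g) ≋ scale b f +ₚ (0# ∷ f *ₚ g)
  *ₚ-∷ʳ []      b g = P.sym 0∷[]≋[]
  *ₚ-∷ʳ (a ∷ f) b g = ∷-cong (+-congʳ (*-comm a b)) (begin
    scale a g +ₚ f *ₚ (b ∷ g)
      ≈⟨ P.∙-congˡ (*ₚ-∷ʳ f b g) ⟩
    scale a g +ₚ (scale b f +ₚ (0# ∷ f *ₚ g))
      ≈⟨ x∙yz≈y∙xz (scale a g) (scale b f) (0# ∷ f *ₚ g) ⟩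
    scale b f +ₚ (a ∷ f) *ₚ g ∎)

  *ₚ-comm : ∀ f g → f *ₚ g ≋ g *ₚ f
  *ₚ-comm f []      = *ₚ-zeroʳ f
  *ₚ-comm f (b ∷ g) =
    P.trans (*ₚ-∷ʳ f b g) (P.∙-congˡ (∷-cong refl (*ₚ-comm f g)))

  *ₚ-congˡ : ∀ f {g h} → g ≋ h → f *ₚ g ≋ f *ₚ h
  *ₚ-congˡ []      g≋h = P.refl
  *ₚ-congˡ (a ∷ f) g≋h = P.∙-cong (scale-cong a g≋h) (∷-cong refl (*ₚ-congˡ f g≋h))

  -- Equal polynomials may be lists of different lengths, which makes recursion on the left factors
  -- awkward. Commutativity moves each change to the right factor, where `*ₚ-congˡ` applies.
  *ₚ-cong : ∀ {f f′ g g′} → f ≋ f′ → g ≋ g′ → f *ₚ g ≋ f′ *ₚ g′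
  *ₚ-cong {f} {f′} {g} {g′} f≋f′ g≋g′ = begin
    f *ₚ g    ≈⟨ *ₚ-congˡ f g≋g′ ⟩
    f *ₚ g′   ≈⟨ *ₚ-comm f g′ ⟩
    g′ *ₚ f   ≈⟨ *ₚ-congˡ g′ f≋f′ ⟩
    g′ *ₚ f′  ≈⟨ *ₚ-comm g′ f′ ⟩
    f′ *ₚ g′  ∎

  scale-*ₚ : ∀ a f g → scale a f *ₚ g ≋ scale a (f *ₚ g)
  scale-*ₚ a []      g = P.refl
  scale-*ₚ a (b ∷ f) g = begin
    scale (a * b) g +ₚ (0# ∷ scale a f *ₚ g)
      ≈⟨ P.∙-cong (scale-scale a b g) (∷-cong (sym (zeroʳ a)) (scale-*ₚ a f g)) ⟩
    scale a (scale b g) +ₚ scale a (0# ∷ f *ₚ g)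
      ≈⟨ scale-distribˡ-+ a (scale b g) (0# ∷ f *ₚ g) ⟨
    scale a ((b ∷ f) *ₚ g) ∎

  *ₚ-assoc : ∀ f g h → (f *ₚ g) *ₚ h ≋ f *ₚ (g *ₚ h)
  *ₚ-assoc []      g h = P.refl
  *ₚ-assoc (a ∷ f) g h = begin
    (scale a g +ₚ (0# ∷ f *ₚ g)) *ₚ h
      ≈⟨ *ₚ-distribʳ-+ₚ h (scale a g) (0# ∷ f *ₚ g) ⟩
    scale a g *ₚ h +ₚ (scale 0# h +ₚ (0# ∷ (f *ₚ g) *ₚ h))
      ≈⟨ P.∙-cong (scale-*ₚ a g h)
           (P.∙-cong (scale-zero h) (∷-cong refl (*ₚ-assoc f g h))) ⟩
    (a ∷ f) *ₚ (g *ₚ h) ∎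

  *ₚ-identityˡ : ∀ f → const 1# *ₚ f ≋ f
  *ₚ-identityˡ f = begin
    scale 1# f +ₚ (0# ∷ [])  ≈⟨ P.∙-cong (scale-identity f) 0∷[]≋[] ⟩
    f +ₚ []                  ≈⟨ P.identityʳ f ⟩
    f                        ∎

  -- The identity map carries the laws from `_≋_` back to the bare coefficient equality, so that the
  -- underlying raw ring is `polynomialRing` itself.
  commutativeRing : CommutativeRing c ℓ
  commutativeRing = record
    { isCommutativeRing =
        RingMonomorphism.isCommutativeRing id-isRingMonomorphism record
          { isRing = record
            { +-isAbelianGroup = +ₚ-isAbelianGroup
            ; *-cong           = *ₚ-cong
            ; *-assoc          = *ₚ-assoc
            ; *-identity       = *ₚ-identityˡ , λ f →
                P.trans (*ₚ-comm f (const 1#)) (*ₚ-identityˡ f)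
            ; distrib          = *ₚ-distribˡ-+ₚ , *ₚ-distribʳ-+ₚ
            }
          ; *-comm = *ₚ-comm
          }
    }
    where
    id-isRingMonomorphism : RingMorphisms.IsRingMonomorphism polynomialRing
      (record { _≈_ = _≋_ ; _+_ = _+ₚ_ ; _*_ = _*ₚ_
              ; -_ = map -_ ; 0# = [] ; 1# = const 1# }) id
    id-isRingMonomorphism = record
      { isRingHomomorphism = record
        { isSemiringHomomorphism = record
          { isNearSemiringHomomorphism = record
            { +-isMonoidHomomorphism = record
              { isMagmaHomomorphism = record
                { isRelHomomorphism = record { cong = coefficientwise }
                ; homo = λ _ _ → P.refl
                }
              ; ε-homo = P.refl
              }
            ; *-homo = λ _ _ → P.refl
            }
          ; 1#-homo = P.refl
          }
        ; -‿homo = λ _ → P.refl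
        }
      ; injective = coefficients
      }

  const-isRingHomomorphism :
    RingMorphisms.IsRingHomomorphism rawRing polynomialRing const
  const-isRingHomomorphism = record
    { isSemiringHomomorphism = record
      { isNearSemiringHomomorphism = record
        { +-isMonoidHomomorphism = record
          { isMagmaHomomorphism = record
            { isRelHomomorphism = record
              { cong = λ a≈b → coefficients (∷-cong a≈b P.refl) }
            ; homo = λ _ _ _ → refl
            }
          ; ε-homo = coefficients 0∷[]≋[]
          }
        ; *-homo = λ a b → coefficients (∷-cong (sym (+-identityʳ (a * b))) P.refl)
        }
      ; 1#-homo = λ _ → refl
      }
    ; -‿homo = λ _ _ → refl
    }

-- Prime divisors of binomial coefficients

prime∤k! : ∀ {p k} → Prime p → k < p → ¬ p ∣ k !
prime∤k! {p} {zero} pr k<p p∣1 = ℕ.<⇒≱ (ℕ.nonTrivial⇒n>1 p) (∣⇒≤ p∣1)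
  where instance _ = prime⇒nonTrivial pr
prime∤k! {p} {suc k} pr k<p p∣k! with euclidsLemma (suc k) (k !) pr p∣k!
... | inj₁ p∣1+k = ℕ.<⇒≱ k<p (∣⇒≤ p∣1+k)
... | inj₂ p∣k!′ = prime∤k! pr (ℕ.<-trans (ℕ.n<1+n k) k<p) p∣k!′

nCk*k![n∸k]!≡n! : ∀ {n k} → k ≤ n → (n C k) ℕ.* (k ! ℕ.* (n ∸ k) !) ≡ n !
nCk*k![n∸k]!≡n! {n} {k} k≤n = ≡.trans
  (≡.cong (ℕ._* (k ! ℕ.* (n ∸ k) !)) (nCk≡n!/k![n-k]! k≤n))
  (m/n*n≡m (k![n∸k]!∣n! k≤n))
  where instance _ = k ℕ.!* (n ∸ k) !≢0

-- The prime divides `p !`, which is `(p C k) * (k ! * (p ∸ k) !)`, but neither factorial, as both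
-- are products of positive numbers below `p`.
p∣pCk : ∀ {p k} → Prime p → 0 < k → k < p → p ∣ p C k
p∣pCk {p@(suc p-1)} {k} pr 0<k k<p
  with euclidsLemma (p C k) (k ! ℕ.* (p ∸ k) !) pr
         (≡.subst (p ∣_) (≡.sym (nCk*k![n∸k]!≡n! (ℕ.<⇒≤ k<p))) (m∣m*n (p-1 !)))
... | inj₁ p∣pCk = p∣pCk
... | inj₂ p∣k![p∸k]! with euclidsLemma (k !) ((p ∸ k) !) pr p∣k![p∸k]!
...   | inj₁ p∣k!     = contradiction p∣k! (prime∤k! pr k<p)
...   | inj₂ p∣[p∸k]! =
  contradiction p∣[p∸k]! (prime∤k! pr (ℕ.∸-monoʳ-< 0<k (ℕ.<⇒≤ k<p)))

-- Binomial sums and the Frobenius rule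

module BinomialSum (S : CommutativeSemiring c ℓ) where
  open CommutativeSemiring S
  open Algebra.Properties.Semiring.Mult semiring
    using (×-assoc-*; ×-assocˡ; ×-congʳ; ×-congˡ; ×-homo-+; ×-homo-1)
    renaming (_×_ to _·_)
  open Algebra.Properties.Semiring.Exp semiring using (_^_)
  open Algebra.Properties.CommutativeMonoid.Sum +-commutativeMonoid
    using (sum; sum-cong-≋; sum-init-last; sum-replicate-zero; ∑-distrib-+)
  open SetoidReasoning setoid

  -- The value at (0 , 0) of (D₁ + D₂)ⁿ T, where D₁ and D₂ shift the two arguments of T.
  binomialSum : ℕ → (ℕ → ℕ → Carrier) → Carrier
  binomialSum zero    T = T 0 0
  binomialSum (suc n) T =
    binomialSum n (λ i j → T (suc i) j) + binomialSum n (λ i j → T i (suc j))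

  -- Only entries with `i + j ≡ n` contribute. Keeping this equation is what later bounds both
  -- indices by a digit and so excludes carries.
  binomialSum-cong : ∀ n {T U} → (∀ i j → i ℕ.+ j ≡ n → T i j ≈ U i j) →
                     binomialSum n T ≈ binomialSum n U
  binomialSum-cong zero    T≈U = T≈U 0 0 ≡.refl
  binomialSum-cong (suc n) T≈U = +-cong
    (binomialSum-cong n λ i j i+j≡n → T≈U (suc i) j (≡.cong suc i+j≡n))
    (binomialSum-cong n λ i j i+j≡n →
      T≈U i (suc j) (≡.trans (ℕ.+-suc i j) (≡.cong suc i+j≡n)))

  -- In operator form, the power of D₁ + D₂ with exponent `m + n` as a composite. Peeling off the
  -- outer steps unfolds both sides alike, so the equality is propositional.
  binomialSum-+ : ∀ m n T → binomialSum (m ℕ.+ n) T ≡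
    binomialSum m (λ i j → binomialSum n (λ i′ j′ → T (i ℕ.+ i′) (j ℕ.+ j′)))
  binomialSum-+ zero    n T = ≡.refl
  binomialSum-+ (suc m) n T = ≡.cong₂ _+_
    (binomialSum-+ m n (λ i j → T (suc i) j))
    (binomialSum-+ m n (λ i j → T i (suc j)))

  *-distribˡ-binomialSum : ∀ n z T →
    z * binomialSum n T ≈ binomialSum n (λ i j → z * T i j)
  *-distribˡ-binomialSum zero    z T = refl
  *-distribˡ-binomialSum (suc n) z T = trans (distribˡ z _ _)
    (+-cong (*-distribˡ-binomialSum n z _) (*-distribˡ-binomialSum n z _))

  *-distribʳ-binomialSum : ∀ n z T →
    binomialSum n T * z ≈ binomialSum n (λ i j → T i j * z)
  *-distribʳ-binomialSum zero    z T = refl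
  *-distribʳ-binomialSum (suc n) z T = trans (distribʳ z _ _)
    (+-cong (*-distribʳ-binomialSum n z _) (*-distribʳ-binomialSum n z _))

  -- On the array `x ^ i * y ^ j` the shifts D₁ and D₂ act as multiplication by `x` and by `y`.
  ^-binomial : ∀ x y n → (x + y) ^ n ≈ binomialSum n (λ i j → x ^ i * y ^ j)
  ^-binomial x y zero    = sym (*-identityˡ 1#)
  ^-binomial x y (suc n) = begin
    (x + y) * (x + y) ^ n
      ≈⟨ *-congˡ (^-binomial x y n) ⟩
    (x + y) * B
      ≈⟨ distribʳ B x y ⟩
    x * B + y * B
      ≈⟨ +-cong (*-distribˡ-binomialSum n x _) (*-distribˡ-binomialSum n y _) ⟩
    binomialSum n (λ i j → x * (x ^ i * y ^ j)) +
    binomialSum n (λ i j → y * (x ^ i * y ^ j))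
      ≈⟨ +-cong (binomialSum-cong n λ i j _ → *-assoc x (x ^ i) (y ^ j))
                (binomialSum-cong n λ i j _ → x∙yz≈y∙xz (x ^ i) y (y ^ j)) ⟨
    binomialSum (suc n) (λ i j → x ^ i * y ^ j) ∎
    where
    open Algebra.Properties.CommutativeSemigroup *-commutativeSemigroup using (x∙yz≈y∙xz)
    B = binomialSum n (λ i j → x ^ i * y ^ j)

  -- Connects the recursion with the closed form in the Binomial Theorem: the two shifted sums are
  -- added termwise by Pascal's rule, apart from the term `t₀`.
  binomialSum≈sum : ∀ n T →
    binomialSum n T ≈ sum {suc n} λ i → (n C toℕ i) · T (toℕ i) (n ∸ toℕ i)
  binomialSum≈sum zero    T = sym (trans (+-identityʳ _) (×-homo-1 (T 0 0)))
  binomialSum≈sum (suc n) T = begin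
    binomialSum n (λ i j → T (suc i) j) + binomialSum n (λ i j → T i (suc j))
      ≈⟨ +-cong (binomialSum≈sum n (λ i j → T (suc i) j))
                (binomialSum≈sum n (λ i j → T i (suc j))) ⟩
    sum a + (t₀ + sum b)
      ≈⟨ x∙yz≈y∙xz (sum a) t₀ (sum b) ⟩
    t₀ + (sum a + sum b)
      ≈⟨ +-congˡ (+-congˡ sum-b≈sum-b⁺) ⟩
    t₀ + (sum a + sum b⁺)
      ≈⟨ +-congˡ (∑-distrib-+ a b⁺) ⟨
    t₀ + sum (λ i → a i + b⁺ i)
      ≈⟨ +-congˡ (sum-cong-≋ {suc n} λ i → trans
           (sym (×-homo-+ (T (suc (toℕ i)) (n ∸ toℕ i)) (n C toℕ i) (n C suc (toℕ i))))
           (×-congˡ (nCk+nC[k+1]≡[n+1]C[k+1] n (toℕ i)))) ⟩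
    sum {suc (suc n)} (λ i → (suc n C toℕ i) · T (toℕ i) (suc n ∸ toℕ i)) ∎
    where
    open Algebra.Properties.CommutativeSemigroup +-commutativeSemigroup using (x∙yz≈y∙xz)
    t₀ : Carrier
    t₀ = 1 · T 0 (suc n)
    a b⁺ : Vector Carrier (suc n)
    a  i = (n C toℕ i) · T (suc (toℕ i)) (n ∸ toℕ i)
    b⁺ i = (n C suc (toℕ i)) · T (suc (toℕ i)) (n ∸ toℕ i)
    b : Vector Carrier n
    b  i = (n C suc (toℕ i)) · T (suc (toℕ i)) (suc (n ∸ suc (toℕ i)))

    -- `b` has one term fewer: the last term of `b⁺` carries the coefficient `n C suc n`, which is
    -- 0. In the other terms `suc (n ∸ suc i)` is `n ∸ i` because `i < n`.
    sum-b≈sum-b⁺ : sum b ≈ sum b⁺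
    sum-b≈sum-b⁺ = begin
      sum b
        ≈⟨ sum-cong-≋ (λ i → reflexive (≡.cong₂
             (λ k l → (n C suc k) · T (suc k) l) (≡.sym (toℕ-inject₁ i))
             (≡.trans (≡.sym (ℕ.+-∸-assoc 1 (toℕ<n i)))
               (≡.cong (n ∸_) (≡.sym (toℕ-inject₁ i)))))) ⟩
      sum (b⁺ ∘ inject₁)
        ≈⟨ +-identityʳ _ ⟨
      sum (b⁺ ∘ inject₁) + 0#
        ≈⟨ +-congˡ (×-congˡ {T (suc (toℕ (fromℕ n))) (n ∸ toℕ (fromℕ n))} (k>n⇒nCk≡0 {n}
             (s≤s (ℕ.≤-reflexive (≡.sym (toℕ-fromℕ n)))))) ⟨
      sum (b⁺ ∘ inject₁) + b⁺ (fromℕ n)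
        ≈⟨ sum-init-last b⁺ ⟨
      sum b⁺ ∎

  -- The operator identity (D₁ + D₂)^q = D₁^q + D₂^q. It is required for all arrays, not only for
  -- `x ^ i * y ^ j`, because it is applied to arrays of digit products.
  Frobenius : ℕ → Set (c ⊔ ℓ)
  Frobenius q = ∀ T → binomialSum q T ≈ T q 0 + T 0 q

  ^-distrib-+ : ∀ {q} → Frobenius q → ∀ x y → (x + y) ^ q ≈ x ^ q + y ^ q
  ^-distrib-+ {q} frob x y = begin
    (x + y) ^ q                              ≈⟨ ^-binomial x y q ⟩
    binomialSum q (λ i j → x ^ i * y ^ j)  ≈⟨ frob _ ⟩
    x ^ q * 1# + 1# * y ^ q                  ≈⟨ +-cong (*-identityʳ _) (*-identityˡ _) ⟩
    x ^ q + y ^ q                            ∎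

  -- The steps are grouped into `k` blocks of `q`. The rule is applied to one block at a time, on
  -- the array of inner sums over the remaining blocks.
  binomialSum-* : ∀ {q} → Frobenius q → ∀ k T →
    binomialSum (k ℕ.* q) T ≈ binomialSum k (λ i j → T (i ℕ.* q) (j ℕ.* q))
  binomialSum-* frob zero    T = refl
  binomialSum-* {q} frob (suc k) T = begin
    binomialSum (q ℕ.+ k ℕ.* q) T
      ≡⟨ binomialSum-+ q (k ℕ.* q) T ⟩
    binomialSum q (λ i j → binomialSum (k ℕ.* q) (λ i′ j′ → T (i ℕ.+ i′) (j ℕ.+ j′)))
      ≈⟨ frob _ ⟩
    binomialSum (k ℕ.* q) (λ i j → T (q ℕ.+ i) j) +
    binomialSum (k ℕ.* q) (λ i j → T i (q ℕ.+ j))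
      ≈⟨ +-cong (binomialSum-* frob k _) (binomialSum-* frob k _) ⟩
    binomialSum (suc k) (λ i j → T (i ℕ.* q) (j ℕ.* q)) ∎

  -- `q ^ suc n` steps form `q` blocks of length `q ^ n`. Each block collapses by induction, and
  -- `frob` treats the `q` long steps that remain. For exponent 0 the rule is the definition of a
  -- one-step sum.
  frobenius-^ : ∀ {q} → Frobenius q → ∀ n → Frobenius (q ℕ.^ n)
  frobenius-^ frob zero    T = refl
  frobenius-^ {q} frob (suc n) T =
    trans (binomialSum-* (frobenius-^ frob n) q T) (frob _)

  -- Every coefficient strictly between the two ends is a multiple of `p` and kills its term, as
  -- `p · x` is `(p · 1#) * x`.
  frobenius-prime : ∀ {p} → Prime p → p · 1# ≈ 0# → Frobenius p
  frobenius-prime {suc p-1} pr p·1≈0 T = begin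
    binomialSum p T
      ≈⟨ binomialSum≈sum p T ⟩
    1 · T 0 p + sum t
      ≈⟨ +-cong (×-homo-1 (T 0 p)) (sum-init-last t) ⟩
    T 0 p + (sum (t ∘ inject₁) + t (fromℕ p-1))
      ≈⟨ +-congˡ (+-cong (trans (sum-cong-≋ middle≈0) (sum-replicate-zero p-1)) last≈) ⟩
    T 0 p + (0# + T p 0)
      ≈⟨ +-congˡ (+-identityˡ _) ⟩
    T 0 p + T p 0
      ≈⟨ +-comm _ _ ⟩
    T p 0 + T 0 p ∎
    where
    p = suc p-1
    t : Vector Carrier p
    t i = (p C suc (toℕ i)) · T (suc (toℕ i)) (p-1 ∸ toℕ i)

    p·x≈0 : ∀ x → p · x ≈ 0#
    p·x≈0 x = begin
      p · x         ≈⟨ ×-congʳ p (*-identityˡ x) ⟨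
      p · (1# * x)  ≈⟨ ×-assoc-* p 1# x ⟨
      (p · 1#) * x  ≈⟨ *-congʳ p·1≈0 ⟩
      0# * x        ≈⟨ zeroˡ x ⟩
      0#            ∎

    p∣n⇒n·x≈0 : ∀ {n} → p ∣ n → ∀ x → n · x ≈ 0#
    p∣n⇒n·x≈0 (divides k ≡.refl) x = begin
      (k ℕ.* p) · x  ≈⟨ ×-congˡ (ℕ.*-comm k p) ⟩
      (p ℕ.* k) · x  ≈⟨ ×-assocˡ x p k ⟨
      p · (k · x)    ≈⟨ p·x≈0 (k · x) ⟩
      0#             ∎

    middle≈0 : ∀ i → t (inject₁ i) ≈ 0#
    middle≈0 i = p∣n⇒n·x≈0 (p∣pCk pr (s≤s z≤n)
      (s≤s (≡.subst (_< p-1) (≡.sym (toℕ-inject₁ i)) (toℕ<n i)))) _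

    last≈ : t (fromℕ p-1) ≈ T p 0
    last≈ = begin
      t (fromℕ p-1)
        ≈⟨ reflexive (≡.cong (λ k → (p C suc k) · T (suc k) (p-1 ∸ k)) (toℕ-fromℕ p-1)) ⟩
      (p C p) · T p (p-1 ∸ p-1)
        ≈⟨ reflexive (≡.cong₂ (λ m l → m · T p l) (nCn≡1 p) (ℕ.n∸n≡0 p-1)) ⟩
      1 · T p 0
        ≈⟨ ×-homo-1 (T p 0) ⟩
      T p 0 ∎

-- Digit expansions and digit products

digit-unique : ∀ {q} (d d′ : Fin q) m m′ →
  toℕ d ℕ.+ m ℕ.* q ≡ toℕ d′ ℕ.+ m′ ℕ.* q → d ≡ d′ × m ≡ m′
digit-unique {q@(suc _)} d d′ m m′ eq = d≡d′ , m≡m′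
  where
  d≡d′ : d ≡ d′
  d≡d′ = toℕ-injective (begin
    toℕ d                        ≡⟨ m<n⇒m%n≡m (toℕ<n d) ⟨
    toℕ d % q                    ≡⟨ [m+kn]%n≡m%n (toℕ d) m q ⟨
    (toℕ d ℕ.+ m ℕ.* q) % q      ≡⟨ ≡.cong (_% q) eq ⟩
    (toℕ d′ ℕ.+ m′ ℕ.* q) % q    ≡⟨ [m+kn]%n≡m%n (toℕ d′) m′ q ⟩
    toℕ d′ % q                   ≡⟨ m<n⇒m%n≡m (toℕ<n d′) ⟩
    toℕ d′                       ∎)
    where open ≡.≡-Reasoning
  m≡m′ : m ≡ m′
  m≡m′ = ℕ.*-cancelʳ-≡ m m′ q (ℕ.+-cancelˡ-≡ (toℕ d) _ _
    (≡.trans eq (≡.cong (λ e → toℕ e ℕ.+ m′ ℕ.* q) (≡.sym d≡d′))))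

module DigitProduct (S : CommutativeSemiring c ℓ) where
  open CommutativeSemiring S
  open BinomialSum S
  open Algebra.Properties.Semiring.Exp semiring using (_^_; ^-congˡ)
  open Algebra.Properties.CommutativeSemigroup *-commutativeSemigroup using (interchange)
  open SetoidReasoning setoid

  -- The recursion of `BinomialSequences.digitProduct` over any commutative semiring, so that values
  -- of polynomials can be inserted for the `u t`.
  digitProduct : ∀ {q} → (ℕ → Carrier) → Expansion q → Carrier
  digitProduct u []       = 1#
  digitProduct u (d ∷ ds) = u 0 ^ toℕ d * digitProduct (u ∘ suc) ds

  digitProduct-congˡ : ∀ {q u v} → (∀ t → u t ≈ v t) → (ds : Expansion q) →
                       digitProduct u ds ≈ digitProduct v ds
  digitProduct-congˡ u≈v []       = refl
  digitProduct-congˡ u≈v (d ∷ ds) =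
    *-cong (^-congˡ (toℕ d) (u≈v 0)) (digitProduct-congˡ (u≈v ∘ suc) ds)

  digitProduct-zero : ∀ {q} u (ds : Expansion q) → fromDigits ds ≡ 0 →
                      digitProduct u ds ≈ 1#
  digitProduct-zero         u []       eq = refl
  digitProduct-zero {suc _} u (d ∷ ds) eq
    with toℕ d | ℕ.m+n≡0⇒m≡0 (toℕ d) eq
       | ℕ.m*n≡0⇒m≡0 (fromDigits ds) _ (ℕ.m+n≡0⇒n≡0 (toℕ d) eq)
  ... | _ | ≡.refl | ds≡0 = trans (*-identityˡ _) (digitProduct-zero (u ∘ suc) ds ds≡0)

  -- Expansions of one number differ only by zeros at the high end, which contribute factors
  -- `u t ^ 0`, that is, 1. Hence it does not matter which expansion `toDigits` returns.
  digitProduct-congʳ : ∀ {q} u (ds es : Expansion q) → fromDigits ds ≡ fromDigits es →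
                       digitProduct u ds ≈ digitProduct u es
  digitProduct-congʳ u []       es       eq = sym (digitProduct-zero u es (≡.sym eq))
  digitProduct-congʳ u (d ∷ ds) []       eq = digitProduct-zero u (d ∷ ds) eq
  digitProduct-congʳ u (d ∷ ds) (e ∷ es) eq
    with digit-unique d e (fromDigits ds) (fromDigits es) eq
  ... | ≡.refl , ds≡es = *-congˡ (digitProduct-congʳ (u ∘ suc) ds es ds≡es)

  module _ {q} (2≤q : 2 ≤ q) where

    digits : ℕ → Expansion q
    digits n = proj₁ (toDigits q {fromWitness 2≤q} n)

    fromDigits-digits : ∀ n → fromDigits (digits n) ≡ n
    fromDigits-digits n = proj₂ (toDigits q {fromWitness 2≤q} n)

    -- The algorithm of `toDigits` is never unfolded: prepending the digit `i` to `digits m` gives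
    -- an expansion of the same number, which suffices.
    digitProduct-digits : ∀ u {i} m → i < q →
      digitProduct u (digits (i ℕ.+ m ℕ.* q)) ≈
      u 0 ^ i * digitProduct (u ∘ suc) (digits m)
    digitProduct-digits u {i} m i<q = begin
      digitProduct u (digits (i ℕ.+ m ℕ.* q))
        ≈⟨ digitProduct-congʳ u (digits (i ℕ.+ m ℕ.* q)) (fromℕ< i<q ∷ digits m) (≡.trans
             (fromDigits-digits (i ℕ.+ m ℕ.* q))
             (≡.sym (≡.cong₂ (λ j k → j ℕ.+ k ℕ.* q) (toℕ-fromℕ< i<q) (fromDigits-digits m)))) ⟩
      u 0 ^ toℕ (fromℕ< i<q) * digitProduct (u ∘ suc) (digits m)
        ≡⟨ ≡.cong (λ j → u 0 ^ j * digitProduct (u ∘ suc) (digits m)) (toℕ-fromℕ< i<q) ⟩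
      u 0 ^ i * digitProduct (u ∘ suc) (digits m) ∎

    -- The induction runs over the list `ds`, which exposes the lowest digit and is structural. The
    -- right-hand side sees only the number `fromDigits ds`.
    digitProduct-+ : Frobenius q → ∀ u v (ds : Expansion q) →
      digitProduct (λ t → u t + v t) ds ≈
      binomialSum (fromDigits ds) (λ i j →
        digitProduct u (digits i) * digitProduct v (digits j))
    digitProduct-+ frob u v [] = sym (trans
      (*-cong (digitProduct-zero u (digits 0) (fromDigits-digits 0))
              (digitProduct-zero v (digits 0) (fromDigits-digits 0)))
      (*-identityˡ 1#))
    digitProduct-+ frob u v (d ∷ ds) = begin
      (u 0 + v 0) ^ r * digitProduct (λ t → u (suc t) + v (suc t)) ds
        ≈⟨ *-cong (^-binomial (u 0) (v 0) r) (digitProduct-+ frob (u ∘ suc) (v ∘ suc) ds) ⟩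
      binomialSum r (λ i j → u 0 ^ i * v 0 ^ j) * binomialSum m T′
        ≈⟨ *-distribʳ-binomialSum r _ _ ⟩
      binomialSum r (λ i j → u 0 ^ i * v 0 ^ j * binomialSum m T′)
        ≈⟨ binomialSum-cong r step ⟨
      binomialSum r (λ i j → binomialSum (m ℕ.* q) (λ i′ j′ → T (i ℕ.+ i′) (j ℕ.+ j′)))
        ≡⟨ binomialSum-+ r (m ℕ.* q) T ⟨
      binomialSum (r ℕ.+ m ℕ.* q) T ∎
      where
      r = toℕ d
      m = fromDigits ds
      T T′ : ℕ → ℕ → Carrier
      T  i j = digitProduct u (digits i) * digitProduct v (digits j)
      T′ i j = digitProduct (u ∘ suc) (digits i) * digitProduct (v ∘ suc) (digits j)

      step : ∀ i j → i ℕ.+ j ≡ r →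
        binomialSum (m ℕ.* q) (λ i′ j′ → T (i ℕ.+ i′) (j ℕ.+ j′)) ≈
        u 0 ^ i * v 0 ^ j * binomialSum m T′
      step i j i+j≡r = begin
        binomialSum (m ℕ.* q) (λ i′ j′ → T (i ℕ.+ i′) (j ℕ.+ j′))
          -- The remaining `m * q` steps now change the arguments by multiples of `q` only, so they
          -- leave the lowest digits alone.
          ≈⟨ binomialSum-* frob m _ ⟩
        binomialSum m (λ i′ j′ → T (i ℕ.+ i′ ℕ.* q) (j ℕ.+ j′ ℕ.* q))
          ≈⟨ binomialSum-cong m (λ i′ j′ _ → trans
               (*-cong (digitProduct-digits u i′ i<q) (digitProduct-digits v j′ j<q))
               (interchange _ _ _ _)) ⟩
        binomialSum m (λ i′ j′ → u 0 ^ i * v 0 ^ j * T′ i′ j′)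
          ≈⟨ *-distribˡ-binomialSum m _ T′ ⟨
        u 0 ^ i * v 0 ^ j * binomialSum m T′ ∎
        where
        -- As `i + j ≡ r` and `r` is a digit, `i` and `j` are below `q`, hence the lowest digits of
        -- `i + i′ * q` and `j + j′ * q`: no carry occurs.
        i<q = ℕ.≤-<-trans (ℕ.≤-trans (ℕ.m≤m+n i j) (ℕ.≤-reflexive i+j≡r)) (toℕ<n d)
        j<q = ℕ.≤-<-trans (ℕ.≤-trans (ℕ.m≤n+m j i) (ℕ.≤-reflexive i+j≡r)) (toℕ<n d)

-- Evaluation of polynomials

module Evaluation (R : CommutativeRing c ℓ) (S : CommutativeRing c′ ℓ′)
  {φ : CommutativeRing.Carrier R → CommutativeRing.Carrier S}
  (φ-homo : RingMorphisms.IsRingHomomorphism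
     (CommutativeRing.rawRing R) (CommutativeRing.rawRing S) φ)
  where

  private
    module R = CommutativeRing R
    module R[x] where
      open RawRing (Polynomial.polynomialRing R.rawRing) public
      open Algebra.Definitions.RawSemiring rawSemiring public using (_^_)
  open CommutativeRing S
  open Polynomial R.rawRing using (Poly; _+ₚ_; _*ₚ_; const; X)
  open RingMorphisms.IsRingHomomorphism φ-homo
  open Algebra.Properties.CommutativeSemigroup +-commutativeSemigroup using (interchange)
  open Algebra.Properties.CommutativeSemigroup *-commutativeSemigroup using (x∙yz≈y∙xz)
  open Algebra.Properties.Semiring.Exp semiring using (_^_)
  open SetoidReasoning setoid

  eval : Poly → Carrier → Carrier
  eval = Polynomial.eval R.rawRing rawRing φ

  -- A polynomial equal to zero may be a nonempty list of zeros. This settles the case of unequal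
  -- lengths in `eval-congˡ`.
  eval-zero : ∀ f s → f R[x].≈ R[x].0# → eval f s ≈ 0#
  eval-zero []      s f≈0 = refl
  eval-zero (a ∷ f) s f≈0 = begin
    φ a + s * eval f s  ≈⟨ +-cong (trans (⟦⟧-cong (f≈0 0)) 0#-homo)
                                  (*-congˡ (eval-zero f s (f≈0 ∘ suc))) ⟩
    0# + s * 0#         ≈⟨ +-identityˡ _ ⟩
    s * 0#              ≈⟨ zeroʳ s ⟩
    0#                  ∎

  eval-congˡ : ∀ f g s → f R[x].≈ g → eval f s ≈ eval g s
  eval-congˡ []      g       s f≈g = sym (eval-zero g s λ n → R.sym (f≈g n))
  eval-congˡ (a ∷ f) []      s f≈g = eval-zero (a ∷ f) s f≈g
  eval-congˡ (a ∷ f) (b ∷ g) s f≈g =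
    +-cong (⟦⟧-cong (f≈g 0)) (*-congˡ (eval-congˡ f g s (f≈g ∘ suc)))

  eval-+ : ∀ f g s → eval (f +ₚ g) s ≈ eval f s + eval g s
  eval-+ []      g       s = sym (+-identityˡ _)
  eval-+ (a ∷ f) []      s = sym (+-identityʳ _)
  eval-+ (a ∷ f) (b ∷ g) s = begin
    φ (a R.+ b) + s * eval (f +ₚ g) s
      ≈⟨ +-cong (+-homo a b) (trans (*-congˡ (eval-+ f g s)) (distribˡ s _ _)) ⟩
    (φ a + φ b) + (s * eval f s + s * eval g s)
      ≈⟨ interchange _ _ _ _ ⟩
    eval (a ∷ f) s + eval (b ∷ g) s ∎

  eval-scale : ∀ a f s → eval (map (a R.*_) f) s ≈ φ a * eval f s
  eval-scale a []      s = sym (zeroʳ (φ a))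
  eval-scale a (b ∷ f) s = begin
    φ (a R.* b) + s * eval (map (a R.*_) f) s
      ≈⟨ +-cong (*-homo a b) (*-congˡ (eval-scale a f s)) ⟩
    φ a * φ b + s * (φ a * eval f s)
      ≈⟨ +-congˡ (x∙yz≈y∙xz s (φ a) _) ⟩
    φ a * φ b + φ a * (s * eval f s)
      ≈⟨ distribˡ (φ a) _ _ ⟨
    φ a * eval (b ∷ f) s ∎

  eval-* : ∀ f g s → eval (f *ₚ g) s ≈ eval f s * eval g s
  eval-* []      g s = sym (zeroˡ _)
  eval-* (a ∷ f) g s = begin
    eval (map (a R.*_) g +ₚ (R.0# ∷ f *ₚ g)) s
      ≈⟨ eval-+ (map (a R.*_) g) (R.0# ∷ f *ₚ g) s ⟩
    eval (map (a R.*_) g) s + (φ R.0# + s * eval (f *ₚ g) s)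
      ≈⟨ +-cong (eval-scale a g s) (trans (+-congʳ 0#-homo) (+-identityˡ _)) ⟩
    φ a * eval g s + s * eval (f *ₚ g) s
      ≈⟨ +-congˡ (trans (*-congˡ (eval-* f g s)) (sym (*-assoc s _ _))) ⟩
    φ a * eval g s + s * eval f s * eval g s
      ≈⟨ distribʳ (eval g s) _ _ ⟨
    eval (a ∷ f) s * eval g s ∎

  eval-const : ∀ a s → eval (const a) s ≈ φ a
  eval-const a s = trans (+-congˡ (zeroʳ s)) (+-identityʳ (φ a))

  eval-1 : ∀ s → eval R[x].1# s ≈ 1#
  eval-1 s = trans (eval-const R.1# s) 1#-homo

  eval-X : ∀ s → eval X s ≈ s
  eval-X s = begin
    φ R.0# + s * eval (const R.1#) s  ≈⟨ +-cong 0#-homo (*-congˡ (eval-1 s)) ⟩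
    0# + s * 1#                       ≈⟨ +-identityˡ _ ⟩
    s * 1#                            ≈⟨ *-identityʳ s ⟩
    s                                 ∎

  eval-^ : ∀ f n s → eval (f R[x].^ n) s ≈ eval f s ^ n
  eval-^ f zero    s = eval-1 s
  eval-^ f (suc n) s = trans (eval-* f (f R[x].^ n) s) (*-congˡ (eval-^ f n s))

-- Additivity of linear polynomials and values of the digit sequence

module _ (F : Field c ℓ) (S : CommutativeRing c′ ℓ′)
  {φ : Field.Carrier F → CommutativeRing.Carrier S}
  (φ-homo : RingMorphisms.IsRingHomomorphism
     (Field.rawRing F) (CommutativeRing.rawRing S) φ)
  where

  private
    module F = Field F
    module F[x]^ = Algebra.Definitions.RawSemiring
      (RawRing.rawSemiring (BinomialSequences.F[x] F))
  open CommutativeRing S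
  open BinomialSequences F using (IsLinear; Sequence; digitSequence)
  open Polynomial F.rawRing using (Poly; _+ₚ_; _*ₚ_; const; X)
  open Evaluation F.commutativeRing S φ-homo
  open BinomialSum commutativeSemiring
  open DigitProduct commutativeSemiring
  open Algebra.Properties.Semiring.Exp semiring using (_^_; ^-congˡ)
  open Algebra.Definitions.RawSemiring (Semiring.rawSemiring semiring)
    using (sum) renaming (_×_ to _·_)
  open Algebra.Properties.CommutativeSemigroup +-commutativeSemigroup using (interchange)
  open SetoidReasoning setoid

  eval-digitProduct : ∀ {q} (E : Sequence) (ds : Expansion q) s →
    eval (BinomialSequences.digitProduct F E ds) s ≈ digitProduct (λ t → eval (E t) s) ds
  eval-digitProduct E []       s = eval-1 s
  eval-digitProduct E (d ∷ ds) s = begin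
    eval (E 0 F[x]^.^ toℕ d *ₚ BinomialSequences.digitProduct F (E ∘ suc) ds) s
      ≈⟨ eval-* (E 0 F[x]^.^ toℕ d) _ s ⟩
    eval (E 0 F[x]^.^ toℕ d) s * eval (BinomialSequences.digitProduct F (E ∘ suc) ds) s
      ≈⟨ *-cong (eval-^ (E 0) (toℕ d) s) (eval-digitProduct (E ∘ suc) ds s) ⟩
    eval (E 0) s ^ toℕ d * digitProduct (λ t → eval (E (suc t)) s) ds ∎

  -- A property of values in `S` rather than a polynomial identity; `S` becomes `F[x,y]`, with `s`
  -- and `t` its two variables.
  Additive : Poly → Set _
  Additive f = ∀ s t → eval f (s + t) ≈ eval f s + eval f t

  +ₚ-additive : ∀ f g → Additive f → Additive g → Additive (f +ₚ g)
  +ₚ-additive f g f-add g-add s t = begin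
    eval (f +ₚ g) (s + t)                          ≈⟨ eval-+ f g (s + t) ⟩
    eval f (s + t) + eval g (s + t)                ≈⟨ +-cong (f-add s t) (g-add s t) ⟩
    (eval f s + eval f t) + (eval g s + eval g t)  ≈⟨ interchange _ _ _ _ ⟩
    (eval f s + eval g s) + (eval f t + eval g t)  ≈⟨ +-cong (eval-+ f g s) (eval-+ f g t) ⟨
    eval (f +ₚ g) s + eval (f +ₚ g) t              ∎

  eval-monomial : ∀ a n s → eval (const a *ₚ X F[x]^.^ n) s ≈ φ a * s ^ n
  eval-monomial a n s = begin
    eval (const a *ₚ X F[x]^.^ n) s
      ≈⟨ eval-* (const a) (X F[x]^.^ n) s ⟩
    eval (const a) s * eval (X F[x]^.^ n) s
      ≈⟨ *-cong (eval-const a s) (trans (eval-^ X n s) (^-congˡ n (eval-X s))) ⟩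
    φ a * s ^ n ∎

  monomial-additive : ∀ {q} → Frobenius q → ∀ a → Additive (const a *ₚ X F[x]^.^ q)
  monomial-additive {q} frob a s t = begin
    eval (const a *ₚ X F[x]^.^ q) (s + t)
      ≈⟨ eval-monomial a q (s + t) ⟩
    φ a * (s + t) ^ q
      ≈⟨ *-congˡ (^-distrib-+ frob s t) ⟩
    φ a * (s ^ q + t ^ q)
      ≈⟨ distribˡ (φ a) _ _ ⟩
    φ a * s ^ q + φ a * t ^ q
      ≈⟨ +-cong (eval-monomial a q s) (eval-monomial a q t) ⟨
    eval (const a *ₚ X F[x]^.^ q) s + eval (const a *ₚ X F[x]^.^ q) t ∎

  sum-additive : ∀ m (f : Vector Poly m) → (∀ i → Additive (f i)) → Additive (F[x]^.sum f)
  sum-additive zero    f f-add s t = sym (+-identityˡ 0#)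
  sum-additive (suc m) f f-add =
    +ₚ-additive (f Fin.zero) _ (f-add Fin.zero)
      (sum-additive m (f ∘ Fin.suc) (f-add ∘ Fin.suc))

  -- All exponents are powers of `q`, so each monomial is additive by the rule iterated in
  -- `frobenius-^`.
  linear⇒additive : ∀ {q} → Frobenius q → ∀ f → IsLinear q f → Additive f
  linear⇒additive frob f (m , as , f≈Σ) s t = begin
    eval f (s + t)       ≈⟨ eval-congˡ f Σ (s + t) f≈Σ ⟩
    eval Σ (s + t)       ≈⟨ sum-additive m _
      (λ n → monomial-additive (frobenius-^ frob (toℕ n)) (as n)) s t ⟩
    eval Σ s + eval Σ t  ≈⟨ +-cong (eval-congˡ f Σ s f≈Σ) (eval-congˡ f Σ t f≈Σ) ⟨
    eval f s + eval f t  ∎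
    where Σ = F[x]^.sum {m} (λ n → const (as n) *ₚ X F[x]^.^ (_ ℕ.^ toℕ n))

  module _ {q} (2≤q : 2 ≤ q) (E : Sequence) where
    private
      P = digitSequence q 2≤q E

    -- Evaluation turns the digit product of the `E k` into that of their values, additivity splits
    -- each value, and `digitProduct-+` expands the result.
    eval-digitSequence-+ : Frobenius q → (∀ t → IsLinear q (E t)) → ∀ n s t →
      eval (P n) (s + t) ≈
        sum {suc n} λ i → (n C toℕ i) · (eval (P (toℕ i)) s * eval (P (n ∸ toℕ i)) t)
    eval-digitSequence-+ frob E-linear n s t = begin
      eval (P n) (s + t)
        ≈⟨ eval-digitProduct E (digits 2≤q n) (s + t) ⟩
      digitProduct (λ k → eval (E k) (s + t)) (digits 2≤q n)
        ≈⟨ digitProduct-congˡ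
             (λ k → linear⇒additive frob (E k) (E-linear k) s t) (digits 2≤q n) ⟩
      digitProduct (λ k → eval (E k) s + eval (E k) t) (digits 2≤q n)
        ≈⟨ digitProduct-+ 2≤q frob _ _ (digits 2≤q n) ⟩
      binomialSum (fromDigits (digits 2≤q n)) T
        ≡⟨ ≡.cong (λ m → binomialSum m T) (fromDigits-digits 2≤q n) ⟩
      binomialSum n T
        ≈⟨ binomialSum-cong n (λ i j _ → *-cong
             (eval-digitProduct E (digits 2≤q i) s) (eval-digitProduct E (digits 2≤q j) t)) ⟨
      binomialSum n (λ i j → eval (P i) s * eval (P j) t)
        ≈⟨ binomialSum≈sum n _ ⟩
      sum {suc n} (λ i → (n C toℕ i) · (eval (P (toℕ i)) s * eval (P (n ∸ toℕ i)) t)) ∎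
      where
      T : ℕ → ℕ → Carrier
      T i j = digitProduct (λ k → eval (E k) s) (digits 2≤q i) *
              digitProduct (λ k → eval (E k) t) (digits 2≤q j)

    -- All digits of 0 vanish, so the convention `e ^ 0 = 1` gives the value 1 even if some `E t` is
    -- zero.
    eval-digitSequence-0 : ∀ s → eval (P 0) s ≈ 1#
    eval-digitSequence-0 s = trans (eval-digitProduct E (digits 2≤q 0) s)
      (digitProduct-zero _ (digits 2≤q 0) (fromDigits-digits 2≤q 0))

-- The characteristic of a field of prime power order

module _ (F : Field c ℓ) where
  open Field F
  open Algebra.Properties.Semiring.Mult semiring
    using (×1-homo-*; ×-homo-1) renaming (_×_ to _·_)
  open Algebra.Properties.CommutativeMonoid.Sum +-commutativeMonoid
    using (sum; sum-cong-≋; sum-permute; ∑-distrib-+; sum-replicate)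
  open Algebra.Properties.Group +-group using (∙-cancelˡ)
  open SetoidReasoning setoid

  -- Translation by 1 permutes the field, so it does not change the sum of all elements.
  order·1≈0 : ∀ n → HasOrder F n → n · 1# ≈ 0#
  order·1≈0 n F≅n = ∙-cancelˡ (sum from) (n · 1#) 0# (begin
    sum from + n · 1#                      ≈⟨ +-congˡ (sum-replicate n) ⟨
    sum from + sum {n} (λ _ → 1#)          ≈⟨ ∑-distrib-+ from (λ _ → 1#) ⟨
    sum (λ i → from i + 1#)                ≈⟨ sum-cong-≋ {n} (λ i → strictlyInverseʳ _) ⟨
    sum (λ i → from (to (from i + 1#)))    ≈⟨ sum-permute from translation ⟨
    sum from                               ≈⟨ +-identityʳ _ ⟨
    sum from + 0#                          ∎)
    where
    open Inverse F≅n
    translation : Permutation n n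
    translation = permutation (λ i → to (from i + 1#)) (λ i → to (from i - 1#))
      (λ i → ≡.trans (to-cong (begin
        from (to (from i - 1#)) + 1#  ≈⟨ +-congʳ (strictlyInverseʳ _) ⟩
        from i - 1# + 1#              ≈⟨ +-assoc _ _ _ ⟩
        from i + (- 1# + 1#)          ≈⟨ +-congˡ (-‿inverseˡ 1#) ⟩
        from i + 0#                   ≈⟨ +-identityʳ _ ⟩
        from i                        ∎)) (strictlyInverseˡ i))
      (λ i → ≡.trans (to-cong (begin
        from (to (from i + 1#)) - 1#  ≈⟨ +-congʳ (strictlyInverseʳ _) ⟩
        from i + 1# - 1#              ≈⟨ +-assoc _ _ _ ⟩
        from i + (1# - 1#)            ≈⟨ +-congˡ (-‿inverseʳ 1#) ⟩
        from i + 0#                   ≈⟨ +-identityʳ _ ⟩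
        from i                        ∎)) (strictlyInverseˡ i))

  -- If `p · 1#` is nonzero, its inverse `y` cancels one factor at a time, down to `1 · 1# ≈ 0#`,
  -- which contradicts `1≉0`. The case distinction is passed as an argument because equality in a
  -- `Field` need not be decidable.
  p^l·1≈0⇒p·1≈0 : ∀ p l → Dec (p · 1# ≈ 0#) → (p ℕ.^ l) · 1# ≈ 0# → p · 1# ≈ 0#
  p^l·1≈0⇒p·1≈0 p zero    _ 1·1≈0 = contradiction (trans (sym (×-homo-1 1#)) 1·1≈0) 1≉0
  p^l·1≈0⇒p·1≈0 p (suc l) (yes p·1≈0) _ = p·1≈0
  p^l·1≈0⇒p·1≈0 p (suc l) (no p·1≉0) p^[1+l]·1≈0 with ≉0⇒invertible p·1≉0
  ... | y , y*p·1≈1 , _ = p^l·1≈0⇒p·1≈0 p l (no p·1≉0) (begin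
    (p ℕ.^ l) · 1#                     ≈⟨ *-identityˡ _ ⟨
    1# * (p ℕ.^ l) · 1#                ≈⟨ *-congʳ y*p·1≈1 ⟨
    y * (p · 1#) * (p ℕ.^ l) · 1#      ≈⟨ *-assoc _ _ _ ⟩
    y * ((p · 1#) * (p ℕ.^ l) · 1#)    ≈⟨ *-congˡ (×1-homo-* p (p ℕ.^ l)) ⟨
    y * ((p ℕ.* p ℕ.^ l) · 1#)         ≈⟨ *-congˡ p^[1+l]·1≈0 ⟩
    y * 0#                             ≈⟨ zeroʳ y ⟩
    0#                                 ∎)

  order-p^l⇒p·1≈0 : ∀ p l → HasOrder F (p ℕ.^ l) → p · 1# ≈ 0#
  order-p^l⇒p·1≈0 p l F≅p^l = p^l·1≈0⇒p·1≈0 p l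
    -- In a finite field equality is decided on the indices in `Fin`.
    (via-injection (Inverse⇒Injection F≅p^l) Fin._≟_ (p · 1#) 0#)
    (order·1≈0 (p ℕ.^ l) F≅p^l)

-- Transport of the characteristic along homomorphisms

module _ (R : CommutativeRing c ℓ) (S : CommutativeRing c′ ℓ′)
  {φ : CommutativeRing.Carrier R → CommutativeRing.Carrier S}
  (φ-homo : RingMorphisms.IsRingHomomorphism
     (CommutativeRing.rawRing R) (CommutativeRing.rawRing S) φ)
  where

  private
    module R  = CommutativeRing R
    module R× = Algebra.Properties.Semiring.Mult R.semiring
  open CommutativeRing S
  open RingMorphisms.IsRingHomomorphism φ-homo
  open Algebra.Properties.Semiring.Mult semiring
    using (×-congʳ) renaming (_×_ to _·_)
  open SetoidReasoning setoid

  ·-homo : ∀ n x → φ (n R×.× x) ≈ n · φ x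
  ·-homo zero    x = 0#-homo
  ·-homo (suc n) x = trans (+-homo x _) (+-congˡ (·-homo n x))

  n·1≈0-homo : ∀ n → n R×.× R.1# R.≈ R.0# → n · 1# ≈ 0#
  n·1≈0-homo n n·1≈0 = begin
    n · 1#           ≈⟨ ×-congʳ n 1#-homo ⟨
    n · φ R.1#       ≈⟨ ·-homo n R.1# ⟨
    φ (n R×.× R.1#)  ≈⟨ ⟦⟧-cong n·1≈0 ⟩
    φ R.0#           ≈⟨ 0#-homo ⟩
    0#               ∎

-- The Binomial Theorem for the digit sequence

open import Data.Nat.Base using (_^_)

proposition5 : ∀ {a b c ℓ} (p l : ℕ) (p-prime : Prime p) (l≥1 : l ≥ 1)
    (K : Field a b) → HasOrder K (p ^ l) →
    (F : Field c ℓ) (ι : Field.Carrier K → Field.Carrier F) →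
    RingMorphisms.IsRingMonomorphism (Field.rawRing K) (Field.rawRing F) ι →
    let open BinomialSequences F in
    (E : Sequence) → (∀ j → IsLinear (p ^ l) (E j)) →
    let P = digitSequence (p ^ l) (2≤p^l p-prime l≥1) E in
    (Nontrivial P × SatisfiesBinomialTheorem P) × generatingFunction P ∈ 𝔅𝔇*
proposition5 p l p-prime l≥1 K K≅q F ι ι-mono E E-linear =
  (nontrivial , binomial) , P , nontrivial , binomial , λ _ _ → F.refl
  where
  module F = Field F
  open BinomialSequences F

  q = p ^ l
  2≤q : 2 ≤ q
  2≤q = 2≤p^l p-prime l≥1

  P : Sequence
  P = digitSequence q 2≤q E

  Fx Fxy : CommutativeRing _ _
  Fx  = PolynomialRing.commutativeRing F.commutativeRing
  Fxy = PolynomialRing.commutativeRing Fx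

  module S = CommutativeRing Fxy

  open BinomialSum S.commutativeSemiring

  -- This is the coefficient embedding used in `_⟨_⟩`, so `eval` along it is the substitution in the
  -- Binomial Theorem.
  const²-homo : RingMorphisms.IsRingHomomorphism F.rawRing F[x,y]
    (Polynomial.const F[x] ∘ Polynomial.const F.rawRing)
  const²-homo = Composition.isRingHomomorphism
    (λ {f} {g} {h} → S.trans {f} {g} {h})
    (PolynomialRing.const-isRingHomomorphism F.commutativeRing)
    (PolynomialRing.const-isRingHomomorphism Fx)

  frobenius : Frobenius q
  -- The relation `p · 1# ≈ 0#` travels from the finite field `K` through `F` to `F[x,y]`.
  frobenius = frobenius-^ (frobenius-prime p-prime
    (n·1≈0-homo F.commutativeRing Fxy const²-homo p
      (n·1≈0-homo (Field.commutativeRing K) F.commutativeRing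
        (RingMorphisms.IsRingMonomorphism.isRingHomomorphism ι-mono) p
        (order-p^l⇒p·1≈0 K p l K≅q)))) l

  nontrivial : Nontrivial P
  -- `P 0` has the value 1 at the point 0, with coefficients mapped by the identity, whereas a zero
  -- polynomial has the value 0 there.
  nontrivial P≈0 = F.1≉0 (F.trans
    (F.sym (eval-digitSequence-0 F F.commutativeRing id-homo 2≤q E F.0#))
    (Evaluation.eval-zero F.commutativeRing F.commutativeRing id-homo (P 0) F.0# (P≈0 0)))
    where
    id-homo = Identity.isRingHomomorphism F.rawRing F.refl

  binomial : SatisfiesBinomialTheorem P
  binomial n =
    eval-digitSequence-+ F Fxy const²-homo 2≤q E frobenius E-linear n x y
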